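{- Let $n$ be a positive integer, let $s\ge 3$ be an integer, let $G$ be the complete bipartite graph $K_{n,n}$, let $\alpha=\left\lfloor \sqrt{2s-2}/2+1\right\rfloor/2$, and let $\mathcal{M}_S$ be a family of at most $\alpha n$ perfect matchings of $G$ (different matchings in the family may share edges). Then there is a perfect matching of $G$ which is $(s-1)$-rainbow and $(2\alpha-1)$-light with respect to $\mathcal{M}_S$.
   Context: A matching $M$ of $G$ is $k$-light with respect to $\mathcal{M}_S$ if no edge of $M$ lies in more than $k$ members of $\mathcal{M}_S$, and $k$-rainbow with respect to $\mathcal{M}_S$ if no member of $\mathcal{M}_S$ contains more than $k$ edges of $M$. -}

module Defs where

open import Data.Nat using (ℕ; _*_; _∸_; _≤_; _<_)
open import Data.Fin using (Fin)
open import Data.Fin.Properties using (_≟_)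
open import Data.Fin.Permutation using (Permutation′; _⟨$⟩ʳ_)
open import Data.List using (List; length; filter; allFin)

-- Vertices of K_{n,n}: left side Fin n, right side Fin n; every left vertex is
-- adjacent to every right vertex.  A perfect matching of K_{n,n} is a bijection
-- σ between the sides; its edges are the pairs (i , σ i).
PerfectMatching : ℕ → Set
PerfectMatching n = Permutation′ n

-- The edge of M at left vertex i lies in P iff P matches i to the same vertex.
-- Number of members of the family (counted with multiplicity) containing
-- the edge of M at left vertex i.
edgeMultiplicity : ∀ {n} → List (PerfectMatching n) → PerfectMatching n → Fin n → ℕ
edgeMultiplicity F M i = length (filter (λ P → (P ⟨$⟩ʳ i) ≟ (M ⟨$⟩ʳ i)) F)

commonEdges : ∀ {n} → PerfectMatching n → PerfectMatching n → ℕ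
commonEdges {n} M P = length (filter (λ i → (P ⟨$⟩ʳ i) ≟ (M ⟨$⟩ʳ i)) (allFin n))

IsLight : ∀ {n} → ℕ → List (PerfectMatching n) → PerfectMatching n → Set
IsLight {n} k F M = (i : Fin n) → edgeMultiplicity F M i ≤ k

IsRainbow : ∀ {n} → ℕ → List (PerfectMatching n) → PerfectMatching n → Set
IsRainbow k F M = ∀ P → P Data.List.Membership.Propositional.∈ F → commonEdges M P ≤ k
  where import Data.List.Membership.Propositional

-- t = ⌊ √(2s-2)/2 + 1 ⌋  (so α = t/2).  For t ≥ 1 this floor is characterised by
-- (2t-2)² ≤ 2s-2 < (2t)²; these two conditions determine t uniquely.
IsTwoAlpha : ℕ → ℕ → Set
IsTwoAlpha s t = ((2 * t ∸ 2) * (2 * t ∸ 2) ≤ 2 * s ∸ 2) × (2 * s ∸ 2 < (2 * t) * (2 * t))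
  where open import Data.Product using (_×_)

{-# OPTIONS --safe #-}
-- Write τ = t − 1 and σ = s − 1; the bound on t gives 1 ≤ τ and 2τ ≤ σ.  Among
-- the partial matchings that are τ-light and σ-rainbow take one of maximum
-- size and, among those, of minimum weight W (the number of incidences between
-- its edges and the family).  Suppose it leaves a row r and its partner column c = πr uncovered.
-- An edge cannot be added iff it is heavy or lies in a saturated member (one that
-- already has σ edges), so give every saturated member the weight t instead of 1:
-- then each edge that cannot be added has weight at least t.  For a matched edge
-- (k , πk) of multiplicity w, maximality and minimality applied to the exchanges
-- that use (r , πk), (k , c) or both show that these two edges together have weight
-- at least w + t, where members one edge short of saturation that contain both
-- edges are charged an extra τ.  For an uncovered pair (k , πk) the bound is t, and
-- it is 2t for k = r, so summing over all k gives W + t(n + 1) on one side.  On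
-- the other side a member contributes at most 2 plus its number of edges in the
-- matching, because 2τ ≤ σ; the total is at most 2|F| + W ≤ tn + W.
module Submission where

open import Defs
open import Data.Nat using (ℕ; _*_; _∸_; _≤_; _≥_)
open import Data.List using (List; length)
open import Data.Product using (Σ; _×_)

open import Data.Bool using (Bool; true; false; if_then_else_)
import Data.Bool.Properties as Bool
open import Data.Fin using (Fin; zero; suc)
open import Data.Fin.Properties using (_≟_; any?)
open import Data.Fin.Permutation
  using (_⟨$⟩ʳ_; _⟨$⟩ˡ_; _∘ₚ_; transpose; inverseˡ; inverseʳ)
  renaming (id to idₚ)
import Data.Fin.Permutation.Components as Components
open import Data.List using ([]; _∷_; map; filter; allFin)
open import Data.List.Membership.Propositional using (_∈_; find; lose)
open import Data.List.Properties using (length-tabulate; map-cong; map-tabulate)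
open import Data.List.Relation.Unary.Any using (here; there) renaming (any? to anyList?)
open import Data.Nat using (zero; suc; _+_; _<_; z≤n; s≤s; s≤s⁻¹; _≤?_)
open import Data.Nat.Induction using (<-wellFounded)
open import Data.Nat.ListAction using (sum)
open import Data.Nat.Properties hiding (_≟_; _≤?_)
import Data.Nat.Properties as ℕ
open import Data.Nat.Tactic.RingSolver using (solve-∀)
open import Data.Product using (_,_; proj₁; proj₂; ∃)
open import Data.Product.Relation.Binary.Lex.Strict using (×-Lex; ×-wellFounded)
open import Data.Sum using (_⊎_; inj₁; inj₂)
open import Data.Vec.Functional using (updateAt)
open import Data.Vec.Functional.Properties using (updateAt-updates; updateAt-minimal)
open import Function using (_∘_; const)
open import Induction.WellFounded using (Acc; acc)
open import Relation.Binary.PropositionalEquality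
open import Relation.Nullary using (Dec; yes; no; ¬_; contradiction)
open import Relation.Nullary.Decidable using (_×-dec_; dec-true; dec-false)
open import Relation.Unary using (Pred; Decidable)

private variable
  A B : Set
  n : ℕ

-- Indicators of decidable propositions

ι : Dec A → ℕ
ι (yes _) = 1
ι (no _)  = 0

ι-true : (d : Dec A) → A → ι d ≡ 1
ι-true (yes _) _ = refl
ι-true (no ¬a) a = contradiction a ¬a

ι-false : (d : Dec A) → ¬ A → ι d ≡ 0
ι-false (yes a) ¬a = contradiction a ¬a
ι-false (no _)  _  = refl

ι≤1 : (d : Dec A) → ι d ≤ 1
ι≤1 (yes _) = ≤-refl
ι≤1 (no _)  = z≤n

ι-cong : (d : Dec A) (e : Dec B) → (A → B) → (B → A) → ι d ≡ ι e
ι-cong (yes a) e f g = sym (ι-true e (f a))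
ι-cong (no ¬a) e f g = sym (ι-false e (¬a ∘ g))

-- Finite sums

∑ : List A → (A → ℕ) → ℕ
∑ xs f = sum (map f xs)

∑-cong : (xs : List A) {f g : A → ℕ} → (∀ x → f x ≡ g x) → ∑ xs f ≡ ∑ xs g
∑-cong xs f≗g = cong sum (map-cong f≗g xs)

∑-mono : (xs : List A) {f g : A → ℕ} → (∀ {x} → x ∈ xs → f x ≤ g x) → ∑ xs f ≤ ∑ xs g
∑-mono []       f≤g = z≤n
∑-mono (x ∷ xs) f≤g = +-mono-≤ (f≤g (here refl)) (∑-mono xs (f≤g ∘ there))

∑-+ : (xs : List A) (f g : A → ℕ) → ∑ xs (λ x → f x + g x) ≡ ∑ xs f + ∑ xs g
∑-+ []       f g = refl
∑-+ (x ∷ xs) f g rewrite ∑-+ xs f g = interchange (f x) (g x) (∑ xs f) (∑ xs g)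
  where
  interchange : ∀ a b c d → a + b + (c + d) ≡ a + c + (b + d)
  interchange = solve-∀

∑-const : (xs : List A) (c : ℕ) → ∑ xs (const c) ≡ length xs * c
∑-const []       c = refl
∑-const (x ∷ xs) c = cong (c +_) (∑-const xs c)

∑-*ʳ : (xs : List A) (f : A → ℕ) (c : ℕ) → ∑ xs (λ x → f x * c) ≡ ∑ xs f * c
∑-*ʳ []       f c = refl
∑-*ʳ (x ∷ xs) f c = trans (cong (f x * c +_) (∑-*ʳ xs f c)) (sym (*-distribʳ-+ c (f x) (∑ xs f)))

∑-swap : (xs : List A) (ys : List B) (f : A → B → ℕ) →
         ∑ xs (λ x → ∑ ys (f x)) ≡ ∑ ys (λ y → ∑ xs (λ x → f x y))
∑-swap []       ys f = sym (trans (∑-const ys 0) (*-zeroʳ (length ys)))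
∑-swap (x ∷ xs) ys f = trans (cong (∑ ys (f x) +_) (∑-swap xs ys f)) (sym (∑-+ ys (f x) _))

∑-if : (b : Bool) (xs : List A) (f : A → ℕ) →
       (if b then ∑ xs f else 0) ≡ ∑ xs (λ x → if b then f x else 0)
∑-if true  xs f = refl
∑-if false xs f = sym (trans (∑-const xs 0) (*-zeroʳ (length xs)))

∑-∈ : {xs : List A} (f : A → ℕ) {x : A} → x ∈ xs → f x ≤ ∑ xs f
∑-∈ f (here refl)         = m≤m+n _ _
∑-∈ f (there {x = y} x∈xs) = ≤-trans (∑-∈ f x∈xs) (m≤n+m _ (f y))

length-filter-ι : {P : Pred A _} (P? : Decidable P) (xs : List A) →
                length (filter P? xs) ≡ ∑ xs (λ x → ι (P? x))
length-filter-ι P? []       = refl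
length-filter-ι P? (x ∷ xs) with P? x
... | yes _ = cong suc (length-filter-ι P? xs)
... | no _  = length-filter-ι P? xs

length-allFin : ∀ n → length (allFin n) ≡ n
length-allFin n = length-tabulate {n = n} (λ i → i)

∑-allFin-suc : (f : Fin (suc n) → ℕ) → ∑ (allFin (suc n)) f ≡ f zero + ∑ (allFin n) (f ∘ suc)
∑-allFin-suc f = cong (λ ys → f zero + sum ys)
  (trans (map-tabulate suc f) (sym (map-tabulate (λ i → i) (f ∘ suc))))

∑-ι : (i : Fin n) → ∑ (allFin n) (λ j → ι (j ≟ i)) ≡ 1
∑-ι {suc n} zero = trans (∑-allFin-suc {n} (λ j → ι (j ≟ zero)))
  (cong suc (trans (∑-const (allFin n) 0) (*-zeroʳ (length (allFin n)))))
∑-ι {suc n} (suc i) = trans (∑-allFin-suc (λ j → ι (j ≟ suc i)))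
  (trans (∑-cong (allFin n) (λ j → ι-cong (suc j ≟ suc i) (j ≟ i) (λ { refl → refl }) (cong suc)))
         (∑-ι i))

∑-ι-cong : {P : Fin n → Set} (P? : ∀ j → Dec (P j)) (i : Fin n) → P i → (∀ j → P j → j ≡ i) →
      ∑ (allFin n) (λ j → ι (P? j)) ≡ 1
∑-ι-cong P? i Pi unique = trans
  (∑-cong (allFin _) (λ j → ι-cong (P? j) (j ≟ i) (unique j) (λ { refl → Pi }))) (∑-ι i)

-- The two sums differ only in the term at `i`. Putting the old and the new term on opposite sides
-- avoids truncated subtraction.
∑-exchange : (f g : Fin n → ℕ) (i : Fin n) → (∀ j → j ≢ i → g j ≡ f j) →
             ∑ (allFin n) g + f i ≡ ∑ (allFin n) f + g i
∑-exchange {n} f g i agree = begin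
  ∑ js g + f i                              ≡⟨ add g (f i) ⟨
  ∑ js (λ j → g j + ι (j ≟ i) * f i)        ≡⟨ ∑-cong js pointwise ⟩
  ∑ js (λ j → f j + ι (j ≟ i) * g i)        ≡⟨ add f (g i) ⟩
  ∑ js f + g i                              ∎
  where
  open ≡-Reasoning
  js = allFin n
  add : (h : Fin n → ℕ) (c : ℕ) → ∑ js (λ j → h j + ι (j ≟ i) * c) ≡ ∑ js h + c
  add h c = trans (∑-+ js h _) (cong (∑ js h +_)
    (trans (∑-*ʳ js _ c) (trans (cong (_* c) (∑-ι i)) (*-identityˡ c))))
  pointwise : ∀ j → g j + ι (j ≟ i) * f i ≡ f j + ι (j ≟ i) * g i
  pointwise j with j ≟ i
  ... | yes refl rewrite +-identityʳ (f j) | +-identityʳ (g j) = +-comm (g j) (f j)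
  ... | no j≢i   = cong (_+ 0) (agree j j≢i)

-- Finite choice: it turns an alternative found row by row into one global alternative, so that the
-- inequalities of all rows can be summed.
⊎-∀ : {P : Set} {Q : Fin n → Set} → (∀ k → P ⊎ Q k) → P ⊎ (∀ k → Q k)
⊎-∀ {zero}  f = inj₂ λ ()
⊎-∀ {suc n} f with f zero | ⊎-∀ (f ∘ suc)
... | inj₁ p | _      = inj₁ p
... | inj₂ _ | inj₁ p = inj₁ p
... | inj₂ q | inj₂ qs = inj₂ λ { zero → q ; (suc k) → qs k }

-- Partial matchings

transpose-matchˡ : (i j : Fin n) → Components.transpose i j i ≡ j
transpose-matchˡ i j rewrite dec-true (i ≟ i) refl = refl

transpose-matchʳ : (i j : Fin n) → Components.transpose i j j ≡ i
transpose-matchʳ i j with j ≟ i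
... | yes j≡i = j≡i
... | no _ rewrite dec-true (j ≟ j) refl = refl

transpose-mismatch : (i j : Fin n) {k : Fin n} → k ≢ i → k ≢ j → Components.transpose i j k ≡ k
transpose-mismatch i j {k} k≢i k≢j
  rewrite dec-false (k ≟ i) k≢i | dec-false (k ≟ j) k≢j = refl

-- A partial matching is a perfect matching together with the set of rows in use;
-- the columns paired with unused rows are uncovered.
record Partial (n : ℕ) : Set where
  constructor _↾_
  field
    matching : PerfectMatching n
    alive    : Fin n → Bool

  col : Fin n → Fin n
  col i = matching ⟨$⟩ʳ i

open Partial

-- Size, level and weight are all instances, so a single update lemma per operation serves the three
-- of them.
total : Partial n → (Fin n → Fin n → ℕ) → ℕ
total {n} S φ = ∑ (allFin n) (λ i → if alive S i then φ i (col S i) else 0)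

size : Partial n → ℕ
size S = total S (λ _ _ → 1)

contains : PerfectMatching n → Fin n → Fin n → ℕ
contains Q i j = ι ((Q ⟨$⟩ʳ i) ≟ j)

level : Partial n → PerfectMatching n → ℕ
level S Q = total S (contains Q)

setRow : Partial n → Fin n → Bool → Partial n
setRow S i b = matching S ↾ updateAt (alive S) i (const b)

swapRows : Partial n → Fin n → Fin n → Partial n
swapRows S i j = (transpose i j ∘ₚ matching S) ↾ alive S

alive-setRow : (S : Partial n) (i : Fin n) (b : Bool) → alive (setRow S i b) i ≡ b
alive-setRow S i b = updateAt-updates i (alive S)

alive-setRow-other : (S : Partial n) {i j : Fin n} (b : Bool) → j ≢ i →
                     alive (setRow S i b) j ≡ alive S j
alive-setRow-other S {i} {j} b j≢i = updateAt-minimal j i (alive S) j≢i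

total-setRow : (S : Partial n) (i : Fin n) (b : Bool) (φ : Fin n → Fin n → ℕ) →
  total (setRow S i b) φ + (if alive S i then φ i (col S i) else 0)
    ≡ total S φ + (if b then φ i (col S i) else 0)
total-setRow S i b φ = trans
  (∑-exchange _ _ i (λ j j≢i →
    cong (λ a → if a then φ j (col S j) else 0) (alive-setRow-other S b j≢i)))
  (cong (λ a → total S φ + (if a then φ i (col S i) else 0)) (alive-setRow S i b))

total-activate : (S : Partial n) {i : Fin n} (φ : Fin n → Fin n → ℕ) → alive S i ≡ false →
  total (setRow S i true) φ ≡ total S φ + φ i (col S i)
total-activate S {i} φ dead with total-setRow S i true φ
... | eq rewrite dead = trans (sym (+-identityʳ _)) eq

total-deactivate : (S : Partial n) {i : Fin n} (φ : Fin n → Fin n → ℕ) → alive S i ≡ true →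
  total (setRow S i false) φ + φ i (col S i) ≡ total S φ
total-deactivate S {i} φ live with total-setRow S i false φ
... | eq rewrite live = trans eq (+-identityʳ _)

module _ (S : Partial n) {i j : Fin n} (deadᵢ : alive S i ≡ false) (deadⱼ : alive S j ≡ false) where

  col-swapRows : ∀ {k} → alive S k ≡ true → col (swapRows S i j) k ≡ col S k
  col-swapRows {k} live = cong (col S) (transpose-mismatch i j (distinct deadᵢ) (distinct deadⱼ))
    where
    distinct : ∀ {l} → alive S l ≡ false → k ≢ l
    distinct dead refl with () ← trans (sym live) dead

  total-swapRows : ∀ φ → total (swapRows S i j) φ ≡ total S φ
  total-swapRows φ = ∑-cong (allFin n) pointwise
    where
    pointwise : ∀ k → (if alive S k then φ k (col (swapRows S i j) k) else 0)
                    ≡ (if alive S k then φ k (col S k) else 0)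
    pointwise k with alive S k in eq
    ... | true  = cong (φ k) (col-swapRows eq)
    ... | false = refl

size≤n : (S : Partial n) → size S ≤ n
size≤n {n} S = begin
  size S                     ≤⟨ ∑-mono (allFin n) (λ {i} _ → bound (alive S i)) ⟩
  ∑ (allFin n) (const 1)     ≡⟨ ∑-const (allFin n) 1 ⟩
  length (allFin n) * 1      ≡⟨ *-identityʳ _ ⟩
  length (allFin n)          ≡⟨ length-allFin n ⟩
  n                          ∎
  where
  open ≤-Reasoning
  bound : ∀ b → (if b then 1 else 0) ≤ 1
  bound true  = ≤-refl
  bound false = z≤n

-- Light and rainbow partial matchings relative to a family

module Family (F : List (PerfectMatching n)) (τ σ : ℕ) where

  mult : Fin n → Fin n → ℕ
  mult i j = ∑ F (λ Q → contains Q i j)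

  weight : Partial n → ℕ
  weight S = total S mult

  -- Double counting of incidences between edges and members. It lets the weight gathered row by row
  -- cancel against the levels gathered member by member.
  weight≡∑level : ∀ S → weight S ≡ ∑ F (level S)
  weight≡∑level S = trans
    (∑-cong (allFin n) (λ i → ∑-if (alive S i) F _))
    (∑-swap (allFin n) F _)

  record Admissible (S : Partial n) : Set where
    field
      light   : ∀ i → alive S i ≡ true → mult i (col S i) ≤ τ
      rainbow : ∀ {Q} → Q ∈ F → level S Q ≤ σ

  open Admissible

  deactivate-admissible : ∀ {S i} → alive S i ≡ true → Admissible S → Admissible (setRow S i false)
  deactivate-admissible {S} {i} live adm .light j live′ with j ≟ i
  ... | yes refl with () ← trans (sym live′) (alive-setRow S i false)
  ... | no j≢i = light adm j (trans (sym (alive-setRow-other S false j≢i)) live′)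
  deactivate-admissible {S} live adm .rainbow {Q} Q∈F = ≤-trans
    (m≤m+n _ _) (≤-trans (≤-reflexive (total-deactivate S (contains Q) live)) (rainbow adm Q∈F))

  swap-admissible : ∀ {S i j} → alive S i ≡ false → alive S j ≡ false →
                    Admissible S → Admissible (swapRows S i j)
  swap-admissible {S} deadᵢ deadⱼ adm .light k live =
    subst (λ c → mult k c ≤ τ) (sym (col-swapRows S deadᵢ deadⱼ live)) (light adm k live)
  swap-admissible {S} deadᵢ deadⱼ adm .rainbow {Q} Q∈F =
    subst (_≤ σ) (sym (total-swapRows S deadᵢ deadⱼ (contains Q))) (rainbow adm Q∈F)

  -- The column is arbitrary rather than `col S i`, so an edge can be tested in `S` before any swap
  -- moves its column. The level bound is strict because adding the edge raises the level by one.
  Fits : Partial n → Fin n → Fin n → Set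
  Fits S i j = mult i j ≤ τ × (∀ {Q} → Q ∈ F → (Q ⟨$⟩ʳ i) ≡ j → level S Q < σ)

  activate-admissible : ∀ {S i} → alive S i ≡ false → Fits S i (col S i) →
                        Admissible S → Admissible (setRow S i true)
  activate-admissible {S} {i} dead (mult≤τ , _) adm .light j live with j ≟ i
  ... | yes refl = mult≤τ
  ... | no j≢i = light adm j (trans (sym (alive-setRow-other S true j≢i)) live)
  activate-admissible {S} {i} dead (_ , unsaturated) adm .rainbow {Q} Q∈F
    rewrite total-activate S (contains Q) dead
    with (Q ⟨$⟩ʳ i) ≟ col S i
  ... | yes Qi≡ = subst (_≤ σ) (+-comm 1 _) (unsaturated Q∈F Qi≡)
  ... | no _    = subst (_≤ σ) (sym (+-identityʳ _)) (rainbow adm Q∈F)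

  -- Measuring improvement

  infix 4 _⊏_
  _⊏_ : ℕ × ℕ → ℕ × ℕ → Set
  _⊏_ = ×-Lex _≡_ _<_ _<_

  -- The size is complemented in `n`, so that going down in the lexicographic order means more edges
  -- first and less weight second.
  rank : Partial n → ℕ × ℕ
  rank S = n ∸ size S , weight S

  Improvement : Partial n → Set
  Improvement S = ∃ λ S′ → Admissible S′ × rank S′ ⊏ rank S

  larger : ∀ S {S′} → Admissible S′ → size S < size S′ → Improvement S
  larger S {S′} adm lt = S′ , adm , inj₁ (∸-monoʳ-< lt (size≤n S′))

  lighter : ∀ S {S′} → Admissible S′ → size S ≡ size S′ → weight S′ < weight S → Improvement S
  lighter S {S′} adm eq lt = S′ , adm , inj₂ (cong (n ∸_) (sym eq) , lt)

  -- Penalised edge weights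

  penalty : Partial n → PerfectMatching n → ℕ
  penalty S Q = 1 + τ * ι (level S Q ℕ.≟ σ)

  penalised : Partial n → Fin n → Fin n → ℕ
  penalised S i j = ∑ F (λ Q → contains Q i j * penalty S Q)

  mult≤penalised : ∀ S i j → mult i j ≤ penalised S i j
  mult≤penalised S i j = ∑-mono F (λ {Q} _ →
    ≤-trans (≤-reflexive (sym (*-identityʳ (contains Q i j))))
            (*-monoʳ-≤ (contains Q i j) (s≤s z≤n)))

  member≤penalised : ∀ S {i j Q} → Q ∈ F → (Q ⟨$⟩ʳ i) ≡ j → penalty S Q ≤ penalised S i j
  member≤penalised S {i} {j} {Q} Q∈F Qi≡j = ≤-trans
    (≤-reflexive (sym (trans (cong (_* penalty S Q) (ι-true ((Q ⟨$⟩ʳ i) ≟ j) Qi≡j)) (*-identityˡ _))))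
    (∑-∈ (λ Q → contains Q i j * penalty S Q) Q∈F)

  -- A single saturated member through the edge would already contribute `1 + τ`, and the penalised
  -- weight dominates the multiplicity.
  fits : ∀ {S i j} → Admissible S → penalised S i j ≤ τ → Fits S i j
  fits {S} {i} {j} adm small .proj₁ = ≤-trans (mult≤penalised S i j) small
  fits {S} {i} {j} adm small .proj₂ {Q} Q∈F Qi≡j = ≤∧≢⇒< (rainbow adm Q∈F) λ saturated →
    <⇒≱ (s≤s small) (≤-trans
      (≤-reflexive (sym (trans (cong (λ x → 1 + τ * x) (ι-true (level S Q ℕ.≟ σ) saturated))
                               (cong suc (*-identityʳ τ)))))
      (member≤penalised S Q∈F Qi≡j))

  -- Exchanges around an uncovered row

  module Step (S : Partial n) (adm : Admissible S) {r : Fin n} (deadᵣ : alive S r ≡ false) where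

    -- These are the members that tolerate either new edge alone but would reach `σ + 1` edges if
    -- both were added.
    collision : Fin n → PerfectMatching n → ℕ
    collision k Q =
      ι (suc (level S Q) ℕ.≟ σ) * (contains Q r (col S k) * contains Q k (col S r)) * τ

    charge : Fin n → ℕ
    charge k = penalised S r (col S k) + penalised S k (col S r) + ∑ F (collision k)

    demand : Fin n → ℕ
    demand k = (if alive S k then mult k (col S k) else 0) + suc τ + ι (k ≟ r) * suc τ

    -- Row `r` and column `col S k` are both uncovered, so a swap pairs them and the edge is added
    -- at no cost. The case `k = r` is included.
    addToDead : ∀ {k} → alive S k ≡ false → Fits S r (col S k) → Improvement S
    addToDead {k} deadₖ (mult≤τ , unsaturated) =
      larger S (activate-admissible deadᵣ fits′ (swap-admissible deadᵣ deadₖ adm)) bigger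
      where
      S₁ = swapRows S r k
      col≡ : col S₁ r ≡ col S k
      col≡ = cong (col S) (transpose-matchˡ r k)
      fits′ : Fits S₁ r (col S₁ r)
      fits′ = subst (λ c → mult r c ≤ τ) (sym col≡) mult≤τ
            , λ {Q} Q∈F Qr≡ → subst (_< σ) (sym (total-swapRows S deadᵣ deadₖ (contains Q)))
                                (unsaturated Q∈F (trans Qr≡ col≡))
      bigger : size S < size (setRow S₁ r true)
      bigger = ≤-reflexive (sym (trans (total-activate S₁ _ deadᵣ)
        (trans (cong (_+ 1) (total-swapRows S deadᵣ deadₖ _)) (+-comm _ 1))))

    module Alive {k : Fin n} (liveₖ : alive S k ≡ true) where

      r≢k : r ≢ k
      r≢k refl with () ← trans (sym liveₖ) deadᵣ

      S₀ S₁ : Partial n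
      S₀ = setRow S k false
      S₁ = swapRows S₀ r k

      dead₁ᵣ : alive S₁ r ≡ false
      dead₁ᵣ = trans (alive-setRow-other S false r≢k) deadᵣ

      dead₁ₖ : alive S₁ k ≡ false
      dead₁ₖ = alive-setRow S k false

      adm₁ : Admissible S₁
      adm₁ = swap-admissible dead₁ᵣ dead₁ₖ (deactivate-admissible liveₖ adm)

      col₁ᵣ : col S₁ r ≡ col S k
      col₁ᵣ = cong (col S) (transpose-matchˡ r k)

      col₁ₖ : col S₁ k ≡ col S r
      col₁ₖ = cong (col S) (transpose-matchʳ r k)

      total₁ : ∀ φ → total S₁ φ + φ k (col S k) ≡ total S φ
      total₁ φ = trans (cong (_+ φ k (col S k)) (total-swapRows S₀ dead₁ᵣ dead₁ₖ φ))
                       (total-deactivate S φ liveₖ)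

      level₁≤ : ∀ Q → level S₁ Q ≤ level S Q
      level₁≤ Q = ≤-trans (m≤m+n _ _) (≤-reflexive (total₁ (contains Q)))

      fits₁ : ∀ {i j} → Fits S i j → col S₁ i ≡ j → Fits S₁ i (col S₁ i)
      fits₁ (mult≤τ , unsaturated) refl =
        mult≤τ , λ {Q} Q∈F Qi≡ → ≤-<-trans (level₁≤ Q) (unsaturated Q∈F Qi≡)

      -- One edge out and one edge in keeps the size, so the gain is in weight. It is used both with
      -- `i = r` and with `i = k`.
      replace : ∀ {i j} → alive S₁ i ≡ false → col S₁ i ≡ j → Fits S i j →
                mult i j < mult k (col S k) → Improvement S
      replace {i} dead refl fit lt = lighter S (activate-admissible dead (fits₁ fit refl) adm₁)
        (sym (trans (total-activate S₁ _ dead) (total₁ _)))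
        (begin-strict
          weight (setRow S₁ i true)            ≡⟨ total-activate S₁ mult dead ⟩
          weight S₁ + mult i (col S₁ i)        <⟨ +-monoʳ-< (weight S₁) lt ⟩
          weight S₁ + mult k (col S k)         ≡⟨ total₁ mult ⟩
          weight S                             ∎)
        where open ≤-Reasoning

      -- One edge leaves and two enter. A member containing both new edges is at least two short of
      -- `σ`, since it is unsaturated and not in collision.
      replaceBoth : Fits S r (col S k) → Fits S k (col S r) →
        (∀ {Q} → Q ∈ F → (Q ⟨$⟩ʳ r) ≡ col S k → (Q ⟨$⟩ʳ k) ≡ col S r → suc (level S Q) ≢ σ) →
        Improvement S
      replaceBoth fitᵣ fitₖ noCollision =
        larger S (activate-admissible dead₂ₖ fit₂
                 (activate-admissible dead₁ᵣ (fits₁ fitᵣ col₁ᵣ) adm₁)) bigger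
        where
        S₂ = setRow S₁ r true
        dead₂ₖ : alive S₂ k ≡ false
        dead₂ₖ = trans (alive-setRow-other S₁ true (r≢k ∘ sym)) dead₁ₖ
        level₂ : ∀ {Q} → Q ∈ F → (Q ⟨$⟩ʳ k) ≡ col S r → level S₂ Q < σ
        level₂ {Q} Q∈F Qk≡
          rewrite total-activate S₁ (contains Q) dead₁ᵣ
          with (Q ⟨$⟩ʳ r) ≟ col S₁ r
        ... | yes Qr≡ = ≤-<-trans
          (subst (_≤ suc (level S Q)) (+-comm 1 _) (s≤s (level₁≤ Q)))
          (≤∧≢⇒< (proj₂ fitₖ Q∈F Qk≡) (noCollision Q∈F (trans Qr≡ col₁ᵣ) Qk≡))
        ... | no _ = subst (_< σ) (sym (+-identityʳ _))
          (≤-<-trans (level₁≤ Q) (proj₂ fitₖ Q∈F Qk≡))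
        fit₂ : Fits S₂ k (col S₂ k)
        fit₂ = subst (λ c → mult k c ≤ τ) (sym col₁ₖ) (proj₁ fitₖ)
             , λ Q∈F Qk≡ → level₂ Q∈F (trans Qk≡ col₁ₖ)
        bigger : size S < size (setRow S₂ k true)
        bigger = ≤-reflexive (sym (begin-equality
          size (setRow S₂ k true)   ≡⟨ total-activate S₂ _ dead₂ₖ ⟩
          size S₂ + 1               ≡⟨ cong (_+ 1) (total-activate S₁ _ dead₁ᵣ) ⟩
          size S₁ + 1 + 1           ≡⟨ cong (_+ 1) (total₁ _) ⟩
          size S + 1                ≡⟨ +-comm _ 1 ⟩
          suc (size S)              ∎))
          where open ≤-Reasoning

      improve⊎charge : Improvement S ⊎ mult k (col S k) + suc τ ≤ charge k
      improve⊎charge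
        with penalised S r (col S k) ≤? τ | penalised S k (col S r) ≤? τ
      -- Neither edge is light enough: one pays `suc τ`, and the other covers the multiplicity of
      -- the old edge, which is at most `τ`.
      ... | no bigᵣ | no bigₖ = inj₂ (≤-trans
            (+-mono-≤ (≤-trans (light adm k liveₖ) (≤-trans (n≤1+n τ) (≰⇒> bigᵣ))) (≰⇒> bigₖ))
            (m≤m+n _ _))
      ... | no bigᵣ | yes smallₖ with mult k (col S k) ≤? mult k (col S r)
      ...   | no lt   = inj₁ (replace dead₁ₖ col₁ₖ (fits adm smallₖ) (≰⇒> lt))
      -- The edge that fits is no lighter than the old one, so it pays for the old multiplicity,
      -- while the other edge pays `suc τ`.
      ...   | yes w≤  = inj₂ (≤-trans (≤-reflexive (+-comm _ (suc τ))) (≤-trans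
              (+-mono-≤ (≰⇒> bigᵣ) (≤-trans w≤ (mult≤penalised S k (col S r))))
              (m≤m+n _ _)))
      improve⊎charge | yes smallᵣ | yesno with mult k (col S k) ≤? mult r (col S k)
      ... | no lt  = inj₁ (replace dead₁ᵣ col₁ᵣ (fits adm smallᵣ) (≰⇒> lt))
      ... | yes w≤ with yesno
      ...   | no bigₖ = inj₂ (≤-trans
              (+-mono-≤ (≤-trans w≤ (mult≤penalised S r (col S k))) (≰⇒> bigₖ)) (m≤m+n _ _))
      ...   | yes smallₖ with anyList? (λ Q → (suc (level S Q) ℕ.≟ σ)
                ×-dec ((Q ⟨$⟩ʳ r) ≟ col S k) ×-dec ((Q ⟨$⟩ʳ k) ≟ col S r)) F
      ...     | no none = inj₁ (replaceBoth (fits adm smallᵣ) (fits adm smallₖ)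
                  (λ Q∈F Qr≡ Qk≡ almost → none (lose Q∈F (almost , Qr≡ , Qk≡))))
      -- The edge at `r` pays for the old multiplicity. The colliding member pays the remaining
      -- `1 + τ`: 1 through the edge at `k` and `τ` through its collision.
      ...     | yes some with find some
      ...       | Q , Q∈F , almost , Qr≡ , Qk≡ = inj₂ (≤-trans
                    (+-mono-≤ (≤-trans w≤ (mult≤penalised S r (col S k)))
                              (+-mono-≤ one≤ τ≤))
                    (≤-reflexive (sym (+-assoc (penalised S r (col S k)) _ _))))
        where
        one≤ : 1 ≤ penalised S k (col S r)
        one≤ = ≤-trans (s≤s z≤n) (member≤penalised S Q∈F Qk≡)
        collision≡τ : collision k Q ≡ τ
        collision≡τ rewrite ι-true (suc (level S Q) ℕ.≟ σ) almost
          | ι-true ((Q ⟨$⟩ʳ r) ≟ col S k) Qr≡ | ι-true ((Q ⟨$⟩ʳ k) ≟ col S r) Qk≡ = *-identityˡ τ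
        τ≤ : τ ≤ ∑ F (collision k)
        τ≤ = subst (_≤ ∑ F (collision k)) collision≡τ (∑-∈ (collision k) Q∈F)

    improve⊎demand : ∀ k → Improvement S ⊎ demand k ≤ charge k
    improve⊎demand k with alive S k in eq | k ≟ r
    ... | true | yes refl with () ← trans (sym eq) deadᵣ
    ... | true | no _ rewrite +-identityʳ (mult k (col S k) + suc τ) = Alive.improve⊎charge eq
    ... | false | _ with penalised S r (col S k) ≤? τ
    ...   | yes small = inj₁ (addToDead eq (fits adm small))
    -- For `k = r` both terms of the charge are the same edge, which is counted twice; this yields
    -- the surplus `suc τ` that decides the final count.
    improve⊎demand k | false | yes refl | no big = inj₂ (≤-trans
      (≤-trans (≤-reflexive (cong (suc τ +_) (+-identityʳ (suc τ)))) (+-mono-≤ (≰⇒> big) (≰⇒> big)))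
      (m≤m+n _ _))
    improve⊎demand k | false | no _ | no big = inj₂ (≤-trans
      (≤-reflexive (+-identityʳ (suc τ)))
      (≤-trans (≰⇒> big) (≤-trans (m≤m+n _ _) (m≤m+n _ _))))

    -- Double counting of demand and charge

    ∑demand : ∑ (allFin n) demand ≡ weight S + n * suc τ + suc τ
    ∑demand = begin
      ∑ (allFin n) demand
        ≡⟨ ∑-+ (allFin n) _ _ ⟩
      ∑ (allFin n) (λ k → (if alive S k then mult k (col S k) else 0) + suc τ)
        + ∑ (allFin n) (λ k → ι (k ≟ r) * suc τ)
        ≡⟨ cong₂ _+_ (trans (∑-+ (allFin n) _ _) (cong (weight S +_) (trans
             (∑-const (allFin n) (suc τ)) (cong (_* suc τ) (length-allFin n)))))
             (trans (∑-*ʳ (allFin n) _ (suc τ)) (trans (cong (_* suc τ) (∑-ι r)) (*-identityˡ _))) ⟩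
      weight S + n * suc τ + suc τ ∎
      where open ≡-Reasoning

    -- As `k` varies, the pairs `(r , col S k)` run once through all edges at row `r`, and a perfect
    -- matching has exactly one of them.
    ∑-row : ∀ Q → ∑ (allFin n) (λ k → contains Q r (col S k)) ≡ 1
    ∑-row Q = ∑-ι-cong (λ k → (Q ⟨$⟩ʳ r) ≟ col S k) (matching S ⟨$⟩ˡ (Q ⟨$⟩ʳ r))
      (sym (inverseʳ (matching S)))
      (λ k Qr≡ → trans (sym (inverseˡ (matching S))) (cong (matching S ⟨$⟩ˡ_) (sym Qr≡)))

    ∑-column : ∀ Q → ∑ (allFin n) (λ k → contains Q k (col S r)) ≡ 1
    ∑-column Q = ∑-ι-cong (λ k → (Q ⟨$⟩ʳ k) ≟ col S r) (Q ⟨$⟩ˡ (col S r))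
      (inverseʳ Q)
      (λ k Qk≡ → trans (sym (inverseˡ Q)) (cong (Q ⟨$⟩ˡ_) Qk≡))

    -- A collision at `k` forces `Q` to match `r` to `col S k`, which happens for one `k` only.
    ∑-collision : ∀ Q → ∑ (allFin n) (λ k → collision k Q) ≤ ι (suc (level S Q) ℕ.≟ σ) * τ
    ∑-collision Q = begin
      ∑ (allFin n) (λ k → collision k Q)
        ≡⟨ ∑-*ʳ (allFin n) _ τ ⟩
      ∑ (allFin n) (λ k → a * (contains Q r (col S k) * contains Q k (col S r))) * τ
        ≤⟨ *-monoˡ-≤ τ (∑-mono (allFin n) (λ {k} _ →
             ≤-trans (*-monoʳ-≤ a (*-monoʳ-≤ (contains Q r (col S k)) (ι≤1 ((Q ⟨$⟩ʳ k) ≟ col S r))))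
                     (≤-reflexive (trans (cong (a *_) (*-identityʳ (contains Q r (col S k))))
                                         (*-comm a (contains Q r (col S k))))))) ⟩
      ∑ (allFin n) (λ k → contains Q r (col S k) * a) * τ
        ≡⟨ cong (_* τ) (trans (∑-*ʳ (allFin n) _ a) (trans (cong (_* a) (∑-row Q)) (*-identityˡ a))) ⟩
      a * τ ∎
      where
      open ≤-Reasoning
      a = ι (suc (level S Q) ℕ.≟ σ)

    -- After exchanging the sums, each member meets row `r` once and column `col S r` once, and so
    -- pays its penalty twice.
    ∑charge : ∑ (allFin n) charge ≤
              ∑ F (λ Q → penalty S Q + penalty S Q + ι (suc (level S Q) ℕ.≟ σ) * τ)
    ∑charge = begin
      ∑ (allFin n) charge
        ≡⟨ trans (∑-+ (allFin n) _ _) (cong₂ _+_ (∑-+ (allFin n) _ _) refl) ⟩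
      ∑ (allFin n) (λ k → penalised S r (col S k)) + ∑ (allFin n) (λ k → penalised S k (col S r))
        + ∑ (allFin n) (λ k → ∑ F (collision k))
        ≤⟨ +-mono-≤ (+-mono-≤
             (≤-reflexive (once (λ Q k → contains Q r (col S k)) ∑-row))
             (≤-reflexive (once (λ Q k → contains Q k (col S r)) ∑-column)))
             (≤-trans (≤-reflexive (∑-swap (allFin n) F collision))
                      (∑-mono F (λ {Q} _ → ∑-collision Q))) ⟩
      ∑ F (penalty S) + ∑ F (penalty S) + ∑ F (λ Q → ι (suc (level S Q) ℕ.≟ σ) * τ)
        ≡⟨ trans (∑-+ F _ _) (cong₂ _+_ (∑-+ F _ _) refl) ⟨
      ∑ F (λ Q → penalty S Q + penalty S Q + ι (suc (level S Q) ℕ.≟ σ) * τ) ∎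
      where
      open ≤-Reasoning
      once : (f : PerfectMatching n → Fin n → ℕ) → (∀ Q → ∑ (allFin n) (f Q) ≡ 1) →
             ∑ (allFin n) (λ k → ∑ F (λ Q → f Q k * penalty S Q)) ≡ ∑ F (penalty S)
      once f f≡1 = trans (∑-swap (allFin n) F _) (∑-cong F (λ Q →
        trans (∑-*ʳ (allFin n) (f Q) (penalty S Q))
              (trans (cong (_* penalty S Q) (f≡1 Q)) (*-identityˡ _))))

  -- The contradiction and the descent

  module _ (1≤τ : 1 ≤ τ) (2τ≤σ : 2 * τ ≤ σ) (2∣F∣≤ : 2 * length F ≤ suc τ * n) where

    contribution : ∀ S Q →
      penalty S Q + penalty S Q + ι (suc (level S Q) ℕ.≟ σ) * τ ≤ 2 + level S Q
    contribution S Q with level S Q ℕ.≟ σ | suc (level S Q) ℕ.≟ σ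
    ... | yes eq | yes eq′ = contradiction (trans eq′ (sym eq)) 1+n≢n
    ... | yes eq | no _ rewrite *-identityʳ τ = begin
      suc τ + suc τ + 0   ≡⟨ rearrange τ ⟩
      2 + 2 * τ           ≤⟨ +-monoʳ-≤ 2 2τ≤σ ⟩
      2 + σ               ≡⟨ cong (2 +_) eq ⟨
      2 + level S Q       ∎
      where
      open ≤-Reasoning
      rearrange : ∀ x → suc x + suc x + 0 ≡ 2 + 2 * x
      rearrange = solve-∀
    -- Here the level is `σ - 1`, so `τ + 1 ≤ σ` is needed; it follows from `τ + 1 ≤ 2τ`, where
    -- `1 ≤ τ` enters.
    ... | no _ | yes eq rewrite *-zeroʳ τ = +-monoʳ-≤ 2 (s≤s⁻¹ (begin
      suc (τ + 0)         ≡⟨ cong suc (+-identityʳ τ) ⟩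
      suc τ               ≡⟨ +-comm 1 τ ⟩
      τ + 1               ≤⟨ +-monoʳ-≤ τ (≤-trans 1≤τ (m≤m+n τ 0)) ⟩
      2 * τ               ≤⟨ 2τ≤σ ⟩
      σ                   ≡⟨ eq ⟨
      suc (level S Q)     ∎))
      where open ≤-Reasoning
    ... | no _ | no _ rewrite *-zeroʳ τ = s≤s (s≤s z≤n)

    improve : ∀ S → Admissible S → ∀ {r} → alive S r ≡ false → Improvement S
    improve S adm {r} dead with ⊎-∀ improve⊎demand
      where open Step S adm dead
    ... | inj₁ better    = better
    ... | inj₂ demanded  = contradiction tooMany (<⇒≱ (begin-strict
        2 * length F + weight S              ≤⟨ +-monoˡ-≤ (weight S) 2∣F∣≤ ⟩
        suc τ * n + weight S                 ≡⟨ +-comm _ (weight S) ⟩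
        weight S + suc τ * n                 ≡⟨ cong (weight S +_) (*-comm (suc τ) n) ⟩
        weight S + n * suc τ                 <⟨ m<m+n _ (s≤s z≤n) ⟩
        weight S + n * suc τ + suc τ         ∎))
      where
      open Step S adm dead
      open ≤-Reasoning
      tooMany : weight S + n * suc τ + suc τ ≤ 2 * length F + weight S
      tooMany = begin
        weight S + n * suc τ + suc τ         ≡⟨ ∑demand ⟨
        ∑ (allFin n) demand                  ≤⟨ ∑-mono (allFin n) (λ {k} _ → demanded k) ⟩
        ∑ (allFin n) charge                  ≤⟨ ∑charge ⟩
        ∑ F (λ Q → penalty S Q + penalty S Q + ι (suc (level S Q) ℕ.≟ σ) * τ)
                                             ≤⟨ ∑-mono F (λ {Q} _ → contribution S Q) ⟩
        ∑ F (λ Q → 2 + level S Q)            ≡⟨ ∑-+ F (const 2) (level S) ⟩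
        ∑ F (const 2) + ∑ F (level S)        ≡⟨ cong₂ _+_ (∑-const F 2) (sym (weight≡∑level S)) ⟩
        length F * 2 + weight S              ≡⟨ cong (_+ weight S) (*-comm (length F) 2) ⟩
        2 * length F + weight S              ∎

    -- Well-founded descent on the rank takes the place of choosing an extremal partial matching.
    complete : ∀ S → Admissible S → Acc _⊏_ (rank S) →
               ∃ λ S′ → Admissible S′ × (∀ i → alive S′ i ≡ true)
    complete S adm (acc rec) with any? (λ i → alive S i Bool.≟ false)
    ... | no none = S , adm , λ i → Bool.¬-not (λ dead → none (i , dead))
    ... | yes (r , dead) with improve S adm dead
    ...   | S′ , adm′ , better = complete S′ adm′ (rec better)

    empty : Partial n
    empty = idₚ ↾ const false

    empty-admissible : Admissible empty
    empty-admissible .light i ()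
    empty-admissible .rainbow _ =
      ≤-trans (≤-reflexive (trans (∑-const (allFin n) 0) (*-zeroʳ (length (allFin n))))) z≤n

    exists-matching : Σ (PerfectMatching n) (λ M → IsRainbow σ F M × IsLight τ F M)
    exists-matching
      with complete empty empty-admissible (×-wellFounded <-wellFounded <-wellFounded _)
    ... | S , adm , full = matching S
        -- All rows are in use, so the guard in `level` is always true and the level equals the
        -- number of common edges.
        , (λ P P∈F → subst (_≤ σ) (sym (trans (length-filter-ι _ (allFin n))
             (∑-cong (allFin n) (λ i → cong (λ b → if b then contains P i (col S i) else 0) (sym (full i))))))
             (rainbow adm P∈F))
        , (λ i → subst (_≤ τ) (sym (length-filter-ι _ F)) (light adm i (full i)))

-- Numerical bounds on the parameter

2m≡2[1+m]∸2 : ∀ x → 2 * x ≡ 2 * suc x ∸ 2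
2m≡2[1+m]∸2 x = sym (cong (_∸ 2) (*-suc 2 x))

twoAlpha-bounds : ∀ s t → s ≥ 3 → IsTwoAlpha s t → 1 ≤ t ∸ 1 × 2 * (t ∸ 1) ≤ s ∸ 1
twoAlpha-bounds (suc σ) zero          (s≤s _)   (_ , ())
-- The value `t = 1` would need `2σ < 4`, whereas `s ≥ 3` gives `σ ≥ 2`.
twoAlpha-bounds (suc σ) (suc zero)    (s≤s 2≤σ) (_ , upper) =
  contradiction upper (≤⇒≯ (subst (4 ≤_) (2m≡2[1+m]∸2 σ) (*-monoʳ-≤ 2 2≤σ)))
twoAlpha-bounds (suc σ) (suc (suc x)) (s≤s _)   (lower , _) = s≤s z≤n , *-cancelˡ-≤ 2 (begin
  2 * (2 * τ)                                    ≡⟨ *-comm 2 (2 * τ) ⟩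
  -- Since `τ ≥ 1`, one factor 2 may be raised to `2τ`, which reaches the square in the lower
  -- condition on `t`.
  (2 * τ) * 2                                    ≤⟨ *-monoʳ-≤ (2 * τ) (*-monoʳ-≤ 2 (s≤s z≤n)) ⟩
  (2 * τ) * (2 * τ)                              ≡⟨ cong₂ _*_ (2m≡2[1+m]∸2 τ) (2m≡2[1+m]∸2 τ) ⟩
  (2 * suc τ ∸ 2) * (2 * suc τ ∸ 2)              ≤⟨ lower ⟩
  2 * suc σ ∸ 2                                  ≡⟨ 2m≡2[1+m]∸2 σ ⟨
  2 * σ                                          ∎)
  where
  open ≤-Reasoning
  τ = suc x

mainTheorem8 : (n s t : ℕ) → n ≥ 1 → s ≥ 3 → IsTwoAlpha s t →
    (F : List (PerfectMatching n)) → 2 * length F ≤ t * n →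
    Σ (PerfectMatching n) (λ M → IsRainbow (s ∸ 1) F M × IsLight (t ∸ 1) F M)
mainTheorem8 n s t _ s≥3 α F 2∣F∣≤ with twoAlpha-bounds s t s≥3 α
mainTheorem8 n s zero    _ _ _ F 2∣F∣≤ | () , _
mainTheorem8 n s (suc τ) _ _ _ F 2∣F∣≤ | 1≤τ , 2τ≤σ =
  Family.exists-matching F τ (s ∸ 1) 1≤τ 2τ≤σ 2∣F∣≤
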